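{- The logic $\mathcal{RDPCH}$ is BP-algebraizable (algebraizable in the sense of Blok and Pigozzi) with the variety $\mathbb{RDPCH}$ of regular dually pseudocomplemented Heyting algebras as its equivalent algebraic semantics.
   Context: Variety. $\mathbb{RDPCH}$ consists of the algebras $\langle A,\vee,\wedge,\to,{}^+,0,1\rangle$ such that $\langle A,\vee,\wedge,\to,0,1\rangle$ is a Heyting algebra, $x^+$ is the least $z$ with $x\vee z=1$, and $(x\wedge x^+)\vee(y\vee y^*)\approx y\vee y^*$ holds with $x^*:=x\to0$. The language $\langle\vee,\wedge,\to,\sim,\bot,\top\rangle$ is interpreted with $\sim$ as ${}^+$, $\bot$ as $0$, $\top$ as $1$. Logics. Formulas are built from a countably infinite set of propositional variables in the language $\langle \vee,\wedge,\to,\sim,\bot,\top\rangle$. Abbreviations: $\alpha\to_H\beta:=\alpha\to(\alpha\wedge\beta)$; $\alpha\leftrightarrow_H\beta:=(\alpha\to_H\beta)\wedge(\beta\to_H\alpha)$; $\beta^*:=\beta\to\bot$. A Hilbert-style logic is the consequence relation $\Gamma\vdash\varphi$ given by finite derivations using elements of $\Gamma$, substitution instances of axioms, and instances of the rules. The logic $\mathcal{DHMSH}$ has axioms: (1) $\alpha\to_H(\alpha\vee\beta)$; (2) $\beta\to_H(\alpha\vee\beta)$; (3) $(\alpha\to_H\gamma)\to_H[(\beta\to_H\gamma)\to_H\{(\alpha\vee\beta)\to_H\gamma\}]$; (4) $(\alpha\wedge\beta)\to_H\alpha$; (5) $(\gamma\to_H\alpha)\to_H[(\gamma\to_H\beta)\to_H(\gamma\to_H(\alpha\wedge\beta))]$;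 (6) $\top$; (7) $\bot\to_H\alpha$; (8) $[(\alpha\wedge\beta)\to_H\gamma]\to_H[\alpha\to_H(\beta\to_H\gamma)]$; (9) $[\alpha\to_H(\beta\to_H\gamma)]\to_H[(\alpha\wedge\beta)\to_H\gamma]$; (10) $(\alpha\to_H\beta)\to_H[(\beta\to_H\alpha)\to_H((\alpha\to\gamma)\to_H(\beta\to\gamma))]$; (11) $(\alpha\to_H\beta)\to_H[(\beta\to_H\alpha)\to_H((\gamma\to\beta)\to_H(\gamma\to\alpha))]$; (12) $\top\to_H\sim\bot$; (13) $\sim\top\to_H\bot$; (14) $\sim(\alpha\wedge\beta)\to_H(\sim\alpha\vee\sim\beta)$; and rules (MP): from $\varphi$ and $\varphi\to_H\gamma$ deduce $\gamma$; (CP): from $\varphi\to_H\gamma$ deduce $\sim\gamma\to_H\sim\varphi$. The logic $\mathcal{RDPCH}$ is the axiomatic extension of $\mathcal{DHMSH}$ (same rules) by: (15) $(\alpha\wedge\beta)\to\alpha$; (16) $\sim\bot\to_H\top$; (17) $\sim\sim(\alpha\vee\beta)\leftrightarrow_H(\sim\sim\alpha\vee\sim\sim\beta)$; (18) $(\sim\sim\alpha\vee\alpha)\leftrightarrow_H\alpha$; (19) $\alpha\vee\sim\alpha$; ($\mathcal M_1$) $((\alpha\wedge\sim\alpha)\vee(\beta\vee\beta^*))\leftrightarrow_H(\beta\vee\beta^*)$. Algebraizability. For a class $\mathbb K$ of algebras, $\Delta\models_{\mathbb K}\alpha\approx\beta$ means: in every $\mathbf A\in\mathbb K$, every valuation satisfying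 all identities in $\Delta$ satisfies $\alpha\approx\beta$. A class $\mathbb K$ is an equivalent algebraic semantics of a logic $\vdash$ if there are finitely many identities $\delta_i(p)\approx\epsilon_i(p)$ in one variable and finitely many formulas $\Delta_j(p,q)$ such that: (A) for all $\Gamma\cup\{\varphi\}$, $\Gamma\vdash\varphi$ iff $\{\delta_i(\psi)\approx\epsilon_i(\psi): i,\ \psi\in\Gamma\}\models_{\mathbb K}\delta_k(\varphi)\approx\epsilon_k(\varphi)$ for all $k$; (B) for all formulas $\varphi,\psi$, $\varphi\approx\psi$ and the set $\{\delta_i(\Delta_j(\varphi,\psi))\approx\epsilon_i(\Delta_j(\varphi,\psi)):i,j\}$ are $\models_{\mathbb K}$-consequences of each other. A logic is BP-algebraizable if it has an equivalent algebraic semantics. -}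

module Defs where

open import Algebra.Core using (Op₁; Op₂)
open import Algebra.Definitions using (Congruent₁; Congruent₂)
open import Data.Fin.Base using (Fin)
open import Data.Nat.Base using (ℕ)
open import Data.Product.Base using (∃; ∃-syntax; _×_)
open import Data.Vec.Functional using ([]; _∷_)
open import Function.Bundles using (_⇔_)
open import Level using (Level; 0ℓ; suc; _⊔_)
open import Relation.Binary.Core using (Rel)
open import Relation.Binary.Structures using (IsEquivalence)
open import Relation.Binary.PropositionalEquality.Core using (_≡_)
open import Relation.Unary using (Pred; _∈_; ｛_｝)
import Relation.Binary.Construct.NaturalOrder.Left as NaturalOrder
open import Relation.Binary.Lattice.Structures using (IsHeytingAlgebra)

private variable
  V W     : Set
  c ℓ g k : Level

infixr 7 _∧_
infixr 6 _∨_
infixr 5 _⟶_ _⟶ᴴ_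
infix  4 _⟷ᴴ_
infix  8 ∼_
infix  9 _*

data Formula (V : Set) : Set where
  var             : V → Formula V
  _∨_ _∧_ _⟶_     : Formula V → Formula V → Formula V
  ∼_              : Formula V → Formula V
  ⊥ ⊤             : Formula V

_⟶ᴴ_ _⟷ᴴ_ : Formula V → Formula V → Formula V
α ⟶ᴴ β = α ⟶ (α ∧ β)
α ⟷ᴴ β = (α ⟶ᴴ β) ∧ (β ⟶ᴴ α)

_* : Formula V → Formula V
β * = β ⟶ ⊥

sub : (V → Formula W) → Formula V → Formula W
sub σ (var x) = σ x
sub σ (α ∨ β) = sub σ α ∨ sub σ β
sub σ (α ∧ β) = sub σ α ∧ sub σ β
sub σ (α ⟶ β) = sub σ α ⟶ sub σ β
sub σ (∼ α)   = ∼ sub σ α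
sub σ ⊥       = ⊥
sub σ ⊤       = ⊤

_⟨_⟩ : Formula (Fin 1) → Formula V → Formula V
α ⟨ φ ⟩ = sub (φ ∷ []) α

_⟨_∣_⟩ : Formula (Fin 2) → Formula V → Formula V → Formula V
α ⟨ φ ∣ ψ ⟩ = sub (φ ∷ ψ ∷ []) α

Fm : Set
Fm = Formula ℕ

Logic : (ℓ : Level) → Set (suc ℓ)
Logic ℓ = Pred Fm ℓ → Fm → Set ℓ

-- Axioms are given as schemes, so a predicate of axioms already contains all
-- of their substitution instances.

data DHMSH-Axiom : Pred Fm 0ℓ where
  ax1  : ∀ α β   → DHMSH-Axiom (α ⟶ᴴ (α ∨ β))
  ax2  : ∀ α β   → DHMSH-Axiom (β ⟶ᴴ (α ∨ β))
  ax3  : ∀ α β γ → DHMSH-Axiom ((α ⟶ᴴ γ) ⟶ᴴ ((β ⟶ᴴ γ) ⟶ᴴ ((α ∨ β) ⟶ᴴ γ)))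
  ax4  : ∀ α β   → DHMSH-Axiom ((α ∧ β) ⟶ᴴ α)
  ax5  : ∀ α β γ → DHMSH-Axiom ((γ ⟶ᴴ α) ⟶ᴴ ((γ ⟶ᴴ β) ⟶ᴴ (γ ⟶ᴴ (α ∧ β))))
  ax6  : DHMSH-Axiom ⊤
  ax7  : ∀ α     → DHMSH-Axiom (⊥ ⟶ᴴ α)
  ax8  : ∀ α β γ → DHMSH-Axiom (((α ∧ β) ⟶ᴴ γ) ⟶ᴴ (α ⟶ᴴ (β ⟶ᴴ γ)))
  ax9  : ∀ α β γ → DHMSH-Axiom ((α ⟶ᴴ (β ⟶ᴴ γ)) ⟶ᴴ ((α ∧ β) ⟶ᴴ γ))
  ax10 : ∀ α β γ → DHMSH-Axiom ((α ⟶ᴴ β) ⟶ᴴ ((β ⟶ᴴ α) ⟶ᴴ ((α ⟶ γ) ⟶ᴴ (β ⟶ γ))))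
  ax11 : ∀ α β γ → DHMSH-Axiom ((α ⟶ᴴ β) ⟶ᴴ ((β ⟶ᴴ α) ⟶ᴴ ((γ ⟶ β) ⟶ᴴ (γ ⟶ α))))
  ax12 : DHMSH-Axiom (⊤ ⟶ᴴ (∼ ⊥))
  ax13 : DHMSH-Axiom ((∼ ⊤) ⟶ᴴ ⊥)
  ax14 : ∀ α β   → DHMSH-Axiom ((∼ (α ∧ β)) ⟶ᴴ ((∼ α) ∨ (∼ β)))

data RDPCH-Axiom : Pred Fm 0ℓ where
  dhmsh : ∀ {α} → DHMSH-Axiom α → RDPCH-Axiom α
  ax15  : ∀ α β → RDPCH-Axiom ((α ∧ β) ⟶ α)
  ax16  : RDPCH-Axiom ((∼ ⊥) ⟶ᴴ ⊤)
  ax17  : ∀ α β → RDPCH-Axiom ((∼ (∼ (α ∨ β))) ⟷ᴴ ((∼ (∼ α)) ∨ (∼ (∼ β))))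
  ax18  : ∀ α   → RDPCH-Axiom (((∼ (∼ α)) ∨ α) ⟷ᴴ α)
  ax19  : ∀ α   → RDPCH-Axiom (α ∨ (∼ α))
  axM₁  : ∀ α β → RDPCH-Axiom (((α ∧ (∼ α)) ∨ (β ∨ (β *))) ⟷ᴴ (β ∨ (β *)))

data Derivable (Ax : Pred Fm 0ℓ) (Γ : Pred Fm ℓ) : Fm → Set ℓ where
  premise : ∀ {φ}   → φ ∈ Γ  → Derivable Ax Γ φ
  axiom   : ∀ {φ}   → φ ∈ Ax → Derivable Ax Γ φ
  MP      : ∀ {φ γ} → Derivable Ax Γ φ → Derivable Ax Γ (φ ⟶ᴴ γ) → Derivable Ax Γ γ
  CP      : ∀ {φ γ} → Derivable Ax Γ (φ ⟶ᴴ γ) → Derivable Ax Γ ((∼ γ) ⟶ᴴ (∼ φ))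

RDPCH-logic : Logic ℓ
RDPCH-logic = Derivable RDPCH-Axiom

-- Algebras of the signature are setoid-based: _≈_ plays the role of equality
-- in the (quotient) algebra.

record Algebra (c ℓ : Level) : Set (suc (c ⊔ ℓ)) where
  infix  9 _⁺
  infixr 7 _⋏_
  infixr 6 _⋎_
  infixr 5 _⇨_
  infix  4 _≈_
  field
    Carrier       : Set c
    _≈_           : Rel Carrier ℓ
    _⋎_ _⋏_ _⇨_   : Op₂ Carrier
    _⁺            : Op₁ Carrier
    𝟎 𝟏           : Carrier
    isEquivalence : IsEquivalence _≈_
    ⋎-cong        : Congruent₂ _≈_ _⋎_
    ⋏-cong        : Congruent₂ _≈_ _⋏_
    ⇨-cong        : Congruent₂ _≈_ _⇨_
    ⁺-cong        : Congruent₁ _≈_ _⁺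

  ⟦_⟧ : Formula V → (V → Carrier) → Carrier
  ⟦ var x ⟧ v = v x
  ⟦ α ∨ β ⟧ v = ⟦ α ⟧ v ⋎ ⟦ β ⟧ v
  ⟦ α ∧ β ⟧ v = ⟦ α ⟧ v ⋏ ⟦ β ⟧ v
  ⟦ α ⟶ β ⟧ v = ⟦ α ⟧ v ⇨ ⟦ β ⟧ v
  ⟦ ∼ α ⟧   v = ⟦ α ⟧ v ⁺
  ⟦ ⊥ ⟧     v = 𝟎
  ⟦ ⊤ ⟧     v = 𝟏

record RDPCH (A : Algebra c ℓ) : Set (c ⊔ ℓ) where
  open Algebra A
  open NaturalOrder _≈_ _⋏_ using (_≤_)
  field
    isHeytingAlgebra : IsHeytingAlgebra _≈_ _≤_ _⋎_ _⋏_ _⇨_ 𝟏 𝟎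
    ⁺-upper          : ∀ x → x ⋎ x ⁺ ≈ 𝟏
    ⁺-least          : ∀ x z → x ⋎ z ≈ 𝟏 → x ⁺ ≤ z
    regular          : ∀ x y → (x ⋏ x ⁺) ⋎ (y ⋎ (y ⇨ 𝟎)) ≈ y ⋎ (y ⇨ 𝟎)

infix 4 _≐_
record Identity : Set where
  constructor _≐_
  field
    lhs rhs : Fm

Satisfies : (A : Algebra c ℓ) → (ℕ → Algebra.Carrier A) → Identity → Set ℓ
Satisfies A v (α ≐ β) = ⟦ α ⟧ v ≈ ⟦ β ⟧ v
  where open Algebra A

infix 3 _⊨[_]_
_⊨[_]_ : Pred Identity g → Pred (Algebra c ℓ) k → Identity → Set (g ⊔ k ⊔ suc (c ⊔ ℓ))
Δ ⊨[ K ] e = ∀ A → A ∈ K → ∀ v → (∀ d → d ∈ Δ → Satisfies A v d) → Satisfies A v e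

record IsEquivalentAlgebraicSemantics (K : Pred (Algebra c ℓ) k) (_⊢_ : Logic g)
       : Set (k ⊔ suc (c ⊔ ℓ ⊔ g)) where
  field
    n   : ℕ
    δ ε : Fin n → Formula (Fin 1)
    m   : ℕ
    Δ   : Fin m → Formula (Fin 2)

  translate : Pred Fm g → Pred Identity g
  translate Γ e = ∃[ i ] ∃[ ψ ] ψ ∈ Γ × e ≡ (δ i ⟨ ψ ⟩ ≐ ε i ⟨ ψ ⟩)

  ΔIdentities : Fm → Fm → Pred Identity 0ℓ
  ΔIdentities φ ψ e =
    ∃[ i ] ∃[ j ] e ≡ (δ i ⟨ Δ j ⟨ φ ∣ ψ ⟩ ⟩ ≐ ε i ⟨ Δ j ⟨ φ ∣ ψ ⟩ ⟩)

  field
    completeness : ∀ Γ φ →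
      (Γ ⊢ φ) ⇔ (∀ i → translate Γ ⊨[ K ] (δ i ⟨ φ ⟩ ≐ ε i ⟨ φ ⟩))
    equivalence⇒ : ∀ φ ψ e → e ∈ ΔIdentities φ ψ → ｛ φ ≐ ψ ｝ ⊨[ K ] e
    equivalence⇐ : ∀ φ ψ → ΔIdentities φ ψ ⊨[ K ] (φ ≐ ψ)

BPAlgebraizable : (c ℓ k : Level) → Logic g → Set (suc (c ⊔ ℓ ⊔ k ⊔ g))
BPAlgebraizable c ℓ k _⊢_ =
  ∃ λ (K : Pred (Algebra c ℓ) k) → IsEquivalentAlgebraicSemantics K _⊢_

{-# OPTIONS --safe #-}
-- The translation is p ≈ ⊤ with equivalence formula p ⟷ᴴ q, and completeness
-- comes from the Lindenbaum algebra.  Two points there are not routine.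
-- The axioms contain neither α ⟶ᴴ α nor transitivity of ⟶ᴴ; both are obtained by
-- reading α ⟶ᴴ β as α ⟶ (α ∧ β) and replacing α or α ∧ β by equivalents with
-- ax10 and ax11.  And ∼ is the dual pseudocomplement: from ⊢ α ∨ γ one gets
-- ⊢ ∼ ∼ α ∨ ∼ ∼ γ, whence ∼ α ≤ (∼ α ∧ ∼ ∼ α) ∨ ∼ ∼ γ, and applying ∼ ∼ removes
-- the first disjunct.
module Submission where

open import Defs
open import Data.Fin.Base using (zero; suc)
open import Data.Nat.Base using (ℕ)
open import Data.Product.Base using (_×_; _,_; proj₂)
open import Function.Bundles using (mk⇔)
open import Level using (Level; _⊔_; Lift; lift; lower)
open import Relation.Binary.Lattice.Structures using (IsHeytingAlgebra)
open import Relation.Binary.PropositionalEquality.Core using (_≡_; refl)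
open import Relation.Unary using (Pred; _∈_)
import Relation.Binary.Construct.NaturalOrder.Left as NaturalOrder

private variable
  c ℓ : Level

-- Order reasoning in an algebra of the variety, and soundness.

module Soundness (A : Algebra c ℓ) (isRDPCH : A ∈ RDPCH) where
  open Algebra A
  open RDPCH isRDPCH
  open NaturalOrder _≈_ _⋏_ using (_≤_)
  open IsHeytingAlgebra isHeytingAlgebra
    renaming (refl to ≤-refl; trans to ≤-trans; antisym to ≤-antisym; reflexive to ≤-reflexive)
    hiding (isEquivalence)

  private variable
    w x y z : Carrier

  _⇨ᴴ_ : Carrier → Carrier → Carrier
  x ⇨ᴴ y = x ⇨ (x ⋏ y)

  -- Hypotheses hold at a variable stage `u`, as in forcing, so nested implications need no explicit
  -- meets.
  ⇨-intro : (∀ {u} → u ≤ w → u ≤ x → u ≤ y) → w ≤ x ⇨ y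
  ⇨-intro f = transpose-⇨ (f (x∧y≤x _ _) (x∧y≤y _ _))

  ⇨-elim : w ≤ x ⇨ y → w ≤ x → w ≤ y
  ⇨-elim p q = ≤-trans (∧-greatest ≤-refl q) (transpose-∧ p)

  ⇨ᴴ-intro : (∀ {u} → u ≤ w → u ≤ x → u ≤ y) → w ≤ x ⇨ᴴ y
  ⇨ᴴ-intro f = ⇨-intro λ p q → ∧-greatest q (f p q)

  ⇨ᴴ-elim : w ≤ x ⇨ᴴ y → w ≤ x → w ≤ y
  ⇨ᴴ-elim p q = ≤-trans (⇨-elim p q) (x∧y≤y _ _)

  ≤⇒⇨ᴴ : x ≤ y → 𝟏 ≤ x ⇨ᴴ y
  ≤⇒⇨ᴴ p = ⇨ᴴ-intro λ _ q → ≤-trans q p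

  ⇨ᴴ⇒≤ : 𝟏 ≤ x ⇨ᴴ y → x ≤ y
  ⇨ᴴ⇒≤ p = ⇨ᴴ-elim (≤-trans (maximum _) p) ≤-refl

  -- Distributivity through residuation: both disjuncts lie below `w ⇨ z`, hence so does `w`.
  ∨-elim : w ≤ x ⋎ y → (∀ {u} → u ≤ w → u ≤ x → u ≤ z) →
           (∀ {u} → u ≤ w → u ≤ y → u ≤ z) → w ≤ z
  ∨-elim p f g = ⇨-elim (≤-trans p
    (∨-least (⇨-intro λ q r → f r q) (⇨-intro λ q r → g r q))) ≤-refl

  ≈𝟏 : 𝟏 ≤ x → x ≈ 𝟏
  ≈𝟏 p = ≤-antisym (maximum _) p

  ≥𝟏 : x ≈ 𝟏 → 𝟏 ≤ x
  ≥𝟏 e = ≤-reflexive (Eq.sym e)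

  x⋎x⁺ : ∀ x → 𝟏 ≤ x ⋎ x ⁺
  x⋎x⁺ x = ≥𝟏 (⁺-upper x)

  ⁺-minimal : 𝟏 ≤ x ⋎ z → x ⁺ ≤ z
  ⁺-minimal p = ⁺-least _ _ (≈𝟏 p)

  ∨-mono : ∀ {x′ y′} → x ≤ x′ → y ≤ y′ → x ⋎ y ≤ x′ ⋎ y′
  ∨-mono p q = ∨-least (≤-trans p (x≤x∨y _ _)) (≤-trans q (y≤x∨y _ _))

  ⁺-anti : x ≤ y → y ⁺ ≤ x ⁺
  ⁺-anti p = ⁺-minimal (≤-trans (x⋎x⁺ _) (∨-mono p ≤-refl))

  ⁺⁺≤ : x ⁺ ⁺ ≤ x
  ⁺⁺≤ = ⁺-minimal (≤-trans (x⋎x⁺ _) (∨-least (y≤x∨y _ _) (x≤x∨y _ _)))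

  𝟏⁺≤𝟎 : 𝟏 ⁺ ≤ 𝟎
  𝟏⁺≤𝟎 = ⁺-minimal (x≤x∨y _ _)

  𝟏≤𝟎⁺ : 𝟏 ≤ 𝟎 ⁺
  𝟏≤𝟎⁺ = ≤-trans (x⋎x⁺ _) (∨-least (minimum _) ≤-refl)

  -- By distributivity, `x ⋎ x ⁺` and `y ⋎ y ⁺` both being the top forces `(x ⋏ y) ⋎ (x ⁺ ⋎ y ⁺)` to
  -- be the top.
  ⁺-⋏ : (x ⋏ y) ⁺ ≤ x ⁺ ⋎ y ⁺
  ⁺-⋏ = ⁺-minimal (∨-elim (x⋎x⁺ _)
    (λ _ p → ∨-elim (≤-trans (maximum _) (x⋎x⁺ _))
      (λ q r → ≤-trans (∧-greatest (≤-trans q p) r) (x≤x∨y _ _))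
      (λ _ r → ≤-trans r (≤-trans (y≤x∨y _ _) (y≤x∨y _ _))))
    (λ _ p → ≤-trans p (≤-trans (x≤x∨y _ _) (y≤x∨y _ _))))

  -- With u = (x ⋎ y) ⁺: x ⁺ ≤ y ⋎ u, hence y ⁺ ≤ u ⋎ x ⁺ ⁺.
  ⁺⁺-⋎ : (x ⋎ y) ⁺ ⁺ ≤ x ⁺ ⁺ ⋎ y ⁺ ⁺
  ⁺⁺-⋎ {x} {y} = ⁺-minimal (≤-trans (x⋎x⁺ _) (∨-least
    (≤-trans y⁺≤ (∨-mono ≤-refl (x≤x∨y _ _))) inʳʳ))
    where
    u = (x ⋎ y) ⁺

    inʳʳ : ∀ {a b d} → d ≤ a ⋎ (b ⋎ d)
    inʳʳ = ≤-trans (y≤x∨y _ _) (y≤x∨y _ _)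

    x⁺≤ : x ⁺ ≤ y ⋎ u
    x⁺≤ = ⁺-minimal (≤-trans (x⋎x⁺ _) (∨-least (∨-mono ≤-refl (x≤x∨y _ _)) inʳʳ))

    y⁺≤ : y ⁺ ≤ u ⋎ x ⁺ ⁺
    y⁺≤ = ⁺-minimal (≤-trans (x⋎x⁺ _) (∨-least
      (≤-trans x⁺≤ (∨-mono ≤-refl (x≤x∨y _ _))) inʳʳ))

  DHMSH-valid : ∀ v {φ} → φ ∈ DHMSH-Axiom → 𝟏 ≤ ⟦ φ ⟧ v
  DHMSH-valid v (ax1 α β) = ≤⇒⇨ᴴ (x≤x∨y _ _)
  DHMSH-valid v (ax2 α β) = ≤⇒⇨ᴴ (y≤x∨y _ _)
  DHMSH-valid v (ax3 α β γ) = ≤⇒⇨ᴴ (⇨ᴴ-intro λ p q → ⇨ᴴ-intro λ r s →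
    ∨-elim s (λ t → ⇨ᴴ-elim (≤-trans t (≤-trans r p)))
             (λ t → ⇨ᴴ-elim (≤-trans t (≤-trans r q))))
  DHMSH-valid v (ax4 α β) = ≤⇒⇨ᴴ (x∧y≤x _ _)
  DHMSH-valid v (ax5 α β γ) = ≤⇒⇨ᴴ (⇨ᴴ-intro λ p q → ⇨ᴴ-intro λ r s →
    ∧-greatest (⇨ᴴ-elim (≤-trans r p) s) (⇨ᴴ-elim (≤-trans r q) s))
  DHMSH-valid v ax6 = ≤-refl
  DHMSH-valid v (ax7 α) = ≤⇒⇨ᴴ (minimum _)
  DHMSH-valid v (ax8 α β γ) = ≤⇒⇨ᴴ (⇨ᴴ-intro λ p q → ⇨ᴴ-intro λ r s →
    ⇨ᴴ-elim (≤-trans r p) (∧-greatest (≤-trans r q) s))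
  DHMSH-valid v (ax9 α β γ) = ≤⇒⇨ᴴ (⇨ᴴ-intro λ p q →
    ⇨ᴴ-elim (⇨ᴴ-elim p (≤-trans q (x∧y≤x _ _))) (≤-trans q (x∧y≤y _ _)))
  DHMSH-valid v (ax10 α β γ) = ≤⇒⇨ᴴ (⇨ᴴ-intro λ p q → ⇨ᴴ-intro λ r s → ⇨-intro λ t u →
    ⇨-elim (≤-trans t s) (⇨ᴴ-elim (≤-trans t (≤-trans r q)) u))
  DHMSH-valid v (ax11 α β γ) = ≤⇒⇨ᴴ (⇨ᴴ-intro λ p q → ⇨ᴴ-intro λ r s → ⇨-intro λ t u →
    ⇨ᴴ-elim (≤-trans t (≤-trans r q)) (⇨-elim (≤-trans t s) u))
  DHMSH-valid v ax12 = ≤⇒⇨ᴴ 𝟏≤𝟎⁺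
  DHMSH-valid v ax13 = ≤⇒⇨ᴴ 𝟏⁺≤𝟎
  DHMSH-valid v (ax14 α β) = ≤⇒⇨ᴴ ⁺-⋏

  RDPCH-valid : ∀ v {φ} → φ ∈ RDPCH-Axiom → 𝟏 ≤ ⟦ φ ⟧ v
  RDPCH-valid v (dhmsh a) = DHMSH-valid v a
  RDPCH-valid v (ax15 α β) = ⇨-intro λ _ p → ≤-trans p (x∧y≤x _ _)
  RDPCH-valid v ax16 = ≤⇒⇨ᴴ (maximum _)
  RDPCH-valid v (ax17 α β) = ∧-greatest (≤⇒⇨ᴴ ⁺⁺-⋎)
    (≤⇒⇨ᴴ (∨-least (⁺-anti (⁺-anti (x≤x∨y _ _))) (⁺-anti (⁺-anti (y≤x∨y _ _)))))
  RDPCH-valid v (ax18 α) = ∧-greatest (≤⇒⇨ᴴ (∨-least ⁺⁺≤ ≤-refl)) (≤⇒⇨ᴴ (y≤x∨y _ _))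
  RDPCH-valid v (ax19 α) = x⋎x⁺ _
  RDPCH-valid v (axM₁ α β) = ∧-greatest (≤⇒⇨ᴴ (≤-reflexive (regular _ _))) (≤⇒⇨ᴴ (y≤x∨y _ _))

  -- `CP` may be applied below premises: an implication of value `𝟏` under the fixed `v` is an
  -- actual inequality, which `_⁺` reverses.
  sound : ∀ {g} {Γ : Pred Fm g} v → (∀ {ψ} → ψ ∈ Γ → ⟦ ψ ⟧ v ≈ 𝟏) →
          ∀ {φ} → RDPCH-logic Γ φ → 𝟏 ≤ ⟦ φ ⟧ v
  sound v h (premise p) = ≥𝟏 (h p)
  sound v h (axiom a)   = RDPCH-valid v a
  sound v h (MP d e)    = ≤-trans (sound v h d) (⇨ᴴ⇒≤ (sound v h e))
  sound v h (CP d)      = ≤⇒⇨ᴴ (⁺-anti (⇨ᴴ⇒≤ (sound v h d)))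

  ⟷ᴴ-valid : ∀ v (φ ψ : Fm) → ⟦ φ ⟧ v ≈ ⟦ ψ ⟧ v → ⟦ φ ⟷ᴴ ψ ⟧ v ≈ 𝟏
  ⟷ᴴ-valid v φ ψ e = ≈𝟏 (∧-greatest (≤⇒⇨ᴴ (≤-reflexive e)) (≤⇒⇨ᴴ (≤-reflexive (Eq.sym e))))

  ⟷ᴴ-equal : ∀ v (φ ψ : Fm) → ⟦ φ ⟷ᴴ ψ ⟧ v ≈ 𝟏 → ⟦ φ ⟧ v ≈ ⟦ ψ ⟧ v
  ⟷ᴴ-equal v φ ψ e = ≤-antisym (⇨ᴴ⇒≤ (≤-trans (≥𝟏 e) (x∧y≤x _ _)))
                               (⇨ᴴ⇒≤ (≤-trans (≥𝟏 e) (x∧y≤y _ _)))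

-- Intuitionistic reasoning derived from the axioms.

module Lindenbaum (Γ : Pred Fm ℓ) where
  infix 3 ⊢_
  infix 4 _≼_ _≋_

  ⊢_ : Fm → Set ℓ
  ⊢ φ = RDPCH-logic Γ φ

  _≼_ _≋_ : Fm → Fm → Set ℓ
  α ≼ β  = ⊢ α ⟶ᴴ β
  α ≋ β = α ≼ β × β ≼ α

  private variable
    α β γ α′ β′ ω : Fm

  ax : DHMSH-Axiom α → ⊢ α
  ax a = axiom (dhmsh a)

  fst : α ∧ β ≼ α
  fst = ax (ax4 _ _)

  inl : α ≼ α ∨ β
  inl = ax (ax1 _ _)

  inr : β ≼ α ∨ β
  inr = ax (ax2 _ _)

  curry : α ∧ β ≼ γ → α ≼ β ⟶ᴴ γ
  curry d = MP d (ax (ax8 _ _ _))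

  uncurry : α ≼ β ⟶ᴴ γ → α ∧ β ≼ γ
  uncurry d = MP d (ax (ax9 _ _ _))

  pair : γ ≼ α → γ ≼ β → γ ≼ α ∧ β
  pair d e = MP e (MP d (ax (ax5 _ _ _)))

  cases : α ≼ γ → β ≼ γ → α ∨ β ≼ γ
  cases d e = MP e (MP d (ax (ax3 _ _ _)))

  weaken : ⊢ β → α ≼ β
  weaken d = MP d (curry fst)

  ⟶-replaceˡ : α ≋ β → ⊢ α ⟶ γ → ⊢ β ⟶ γ
  ⟶-replaceˡ (d , e) p = MP p (MP e (MP d (ax (ax10 _ _ _))))

  ⟶-replaceʳ : α ≋ β → ⊢ γ ⟶ α → ⊢ γ ⟶ β
  ⟶-replaceʳ (d , e) p = MP p (MP d (MP e (ax (ax11 _ _ _))))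

  -- A = (α ∨ ⊥) ∧ ⊤ is equivalent to α and satisfies A ≼ A without using α ≼ α.
  ≼-refl : α ≼ α
  ≼-refl {α} = ⟶-replaceʳ (A∧A≼α∧α , α∧α≼A∧A) (⟶-replaceˡ (A≼α , α≼A) A≼A)
    where
    A = (α ∨ ⊥) ∧ ⊤

    α≼A : α ≼ A
    α≼A = pair inl (weaken (ax ax6))

    A≼α : A ≼ α
    A≼α = uncurry (cases (curry fst) (ax (ax7 _)))

    A≼A : A ≼ A
    A≼A = pair fst (weaken (ax ax6))

    α∧α≼A∧A : α ∧ α ≼ A ∧ A
    α∧α≼A∧A = pair (uncurry (weaken α≼A)) (uncurry (weaken α≼A))

    A∧A≼α∧α : A ∧ A ≼ α ∧ α
    A∧A≼α∧α = pair (uncurry (weaken A≼α)) (uncurry (weaken A≼α))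

  snd : α ∧ β ≼ β
  snd = uncurry (weaken ≼-refl)

  -- α ⟶ (α ∧ β) is rewritten along α ∧ β ≋ γ ∧ α ≋ α ∧ γ.
  ≼-trans : α ≼ β → β ≼ γ → α ≼ γ
  ≼-trans d e = ⟶-replaceʳ (pair snd fst , pair snd fst)
    (⟶-replaceʳ (pair (uncurry (weaken e)) fst , pair snd (uncurry (weaken d))) d)

  -- Modus ponens under a context `ω`, by which axioms with nested implications are used on
  -- hypotheses.
  app : ω ≼ α ⟶ᴴ β → ω ≼ α → ω ≼ β
  app d e = ≼-trans (pair ≼-refl e) (uncurry d)

  swap : α ∧ β ≼ β ∧ α
  swap = pair snd fst

  ⊤-intro : ω ≼ ⊤
  ⊤-intro = weaken (ax ax6)

  -- Under ω both α ≋ ⊤ and β ≋ ⊤ ∧ β hold, so α ⟶ β becomes ⊤ ⟶ᴴ β.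
  ⟶-elim : ω ≼ α ⟶ β → ω ≼ α → ω ≼ β
  ⟶-elim d e = app (app (app (app (weaken (ax (ax11 _ _ _)))
      (weaken snd)) (weaken (pair ⊤-intro ≼-refl))) ⊤⟶β) ⊤-intro
    where ⊤⟶β = app (app (app (weaken (ax (ax10 _ _ _))) (weaken ⊤-intro)) (curry (≼-trans fst e))) d

  -- `ax15`, commuted, gives `(α ∧ β) ⟶ β`. Under `ω` the formulas `α ∧ β` and `α` are equivalent,
  -- so `ax10` turns the antecedent into `α`.
  ⟶-intro : ω ∧ α ≼ β → ω ≼ α ⟶ β
  ⟶-intro d = app (app (app (weaken (ax (ax10 _ _ _))) (weaken fst)) (curry (pair snd d)))
    (weaken (⟶-replaceˡ (swap , swap) (axiom (ax15 _ _))))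

  -- Dual pseudocomplement and monotonicity of the connectives.

  ∼-anti : α ≼ β → ∼ β ≼ ∼ α
  ∼-anti = CP

  ∧-mono : α ≼ α′ → β ≼ β′ → α ∧ β ≼ α′ ∧ β′
  ∧-mono d e = pair (≼-trans fst d) (≼-trans snd e)

  ∨-mono : α ≼ α′ → β ≼ β′ → α ∨ β ≼ α′ ∨ β′
  ∨-mono d e = cases (≼-trans d inl) (≼-trans e inr)

  ⟶-mono : α′ ≼ α → β ≼ β′ → α ⟶ β ≼ α′ ⟶ β′
  ⟶-mono d e = ⟶-intro (≼-trans (⟶-elim fst (≼-trans snd d)) e)

  ∼∼-elim : ∼ ∼ α ≼ α
  ∼∼-elim = ≼-trans inl (MP (axiom (ax18 _)) fst)

  ∼∼-mono : α ≼ β → ∼ ∼ α ≼ ∼ ∼ β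
  ∼∼-mono d = ∼-anti (∼-anti d)

  -- From `⊤ ≼ α` follows `∼ α ≼ ∼ ⊤ ≼ ⊥`, hence `∼ ⊥ ≼ ∼ ∼ α`, and `∼ ⊥` is a theorem.
  ∼∼-⊢ : ⊢ α → ⊢ ∼ ∼ α
  ∼∼-⊢ d = MP (MP (ax ax6) (ax ax12)) (∼-anti (≼-trans (∼-anti (weaken d)) (ax ax13)))

  ∼∼-∨ : ∼ ∼ (α ∨ β) ≼ ∼ ∼ α ∨ ∼ ∼ β
  ∼∼-∨ = MP (axiom (ax17 _ _)) fst

  -- Each disjunct of `∼ α ∨ ∼ ∼ α` entails `∼ (α ∧ ∼ α)`, which is therefore a theorem.
  ∼∼-∧∼ : ∼ ∼ (α ∧ ∼ α) ≼ ⊥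
  ∼∼-∧∼ = ≼-trans (∼-anti (weaken (MP (axiom (ax19 (∼ _))) (cases
    (∼-anti fst) (∼-anti snd))))) (ax ax13)

  ∼-least : ⊢ α ∨ γ → ∼ α ≼ γ
  -- The chain opens with `∼ α ≼ ∼ ∼ ∼ α`, so that applying `∼ ∼` to the bound `∼α≼` still bounds
  -- `∼ α`.
  ∼-least {α} {γ} d = ≼-trans (≼-trans (∼-anti ∼∼-elim) (≼-trans (∼∼-mono ∼α≼)
    (≼-trans ∼∼-∨ (cases (≼-trans ∼∼-∧∼ (ax (ax7 _))) ∼∼-elim)))) ∼∼-elim
    where
    ∼α≼ : ∼ α ≼ ((∼ α) ∧ (∼ ∼ α)) ∨ ∼ ∼ γ
    -- Case split on the theorem `∼ ∼ α ∨ ∼ ∼ γ`, with `∼ α` kept as the antecedent of each case.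
    ∼α≼ = app (≼-trans (weaken (MP (∼∼-⊢ d) ∼∼-∨)) (cases
      (curry (≼-trans swap inl)) (curry (≼-trans fst inr)))) ≼-refl

-- The Lindenbaum algebra of `Γ` and its canonical valuation.

module _ {c ℓ : Level} (Γ : Pred Fm ℓ) where
  open Lindenbaum Γ

  -- `Lift` places the formulas at the arbitrary level `c`; derivability from `Γ` already puts the
  -- equality at level `ℓ`.
  lindenbaum : Algebra c ℓ
  lindenbaum = record
    { Carrier       = Lift c Fm
    ; _≈_           = λ a b → lower a ≋ lower b
    ; _⋎_           = λ a b → lift (lower a ∨ lower b)
    ; _⋏_           = λ a b → lift (lower a ∧ lower b)
    ; _⇨_           = λ a b → lift (lower a ⟶ lower b)
    ; _⁺            = λ a → lift (∼ lower a)
    ; 𝟎             = lift ⊥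
    ; 𝟏             = lift ⊤
    ; isEquivalence = record
      { refl  = ≼-refl , ≼-refl
      ; sym   = λ (d , e) → e , d
      ; trans = λ (d , e) (f , g) → ≼-trans d f , ≼-trans g e
      }
    ; ⋎-cong        = λ (d , e) (f , g) → ∨-mono d f , ∨-mono e g
    ; ⋏-cong        = λ (d , e) (f , g) → ∧-mono d f , ∧-mono e g
    ; ⇨-cong        = λ (d , e) (f , g) → ⟶-mono e f , ⟶-mono d g
    ; ⁺-cong        = λ (d , e) → ∼-anti e , ∼-anti d
    }

  open Algebra lindenbaum
  open NaturalOrder _≈_ _⋏_ using (_≤_)

  ≤⇒≼ : ∀ {a b} → a ≤ b → lower a ≼ lower b
  ≤⇒≼ (d , _) = ≼-trans d snd

  ≼⇒≤ : ∀ {a b} → lower a ≼ lower b → a ≤ b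
  ≼⇒≤ d = pair ≼-refl d , fst

  lindenbaum∈RDPCH : lindenbaum ∈ RDPCH
  lindenbaum∈RDPCH = record
    { isHeytingAlgebra = record
      { isBoundedLattice = record
        { isLattice = record
          { isPartialOrder = record
            { isPreorder = record
              { isEquivalence = isEquivalence
              ; reflexive     = λ (d , _) → ≼⇒≤ d
              ; trans         = λ p q → ≼⇒≤ (≼-trans (≤⇒≼ p) (≤⇒≼ q))
              }
            ; antisym = λ p q → ≤⇒≼ p , ≤⇒≼ q
            }
          ; supremum = λ _ _ → ≼⇒≤ inl , ≼⇒≤ inr , λ _ p q → ≼⇒≤ (cases (≤⇒≼ p) (≤⇒≼ q))
          ; infimum  = λ _ _ → ≼⇒≤ fst , ≼⇒≤ snd , λ _ p q → ≼⇒≤ (pair (≤⇒≼ p) (≤⇒≼ q))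
          }
        ; maximum = λ _ → ≼⇒≤ ⊤-intro
        ; minimum = λ _ → ≼⇒≤ (ax (ax7 _))
        }
      ; exponential = λ _ _ _ →
          (λ p → ≼⇒≤ (⟶-intro (≤⇒≼ p))) ,
          (λ p → ≼⇒≤ (⟶-elim (≼-trans fst (≤⇒≼ p)) snd))
      }
    ; ⁺-upper = λ _ → ⊤-intro , weaken (axiom (ax19 _))
    ; ⁺-least = λ _ _ (_ , d) → ≼⇒≤ (∼-least (MP (ax ax6) d))
    ; regular = λ _ _ → MP (axiom (axM₁ _ _)) fst , MP (axiom (axM₁ _ _)) snd
    }

  canonical : ℕ → Carrier
  canonical n = lift (var n)

  -- Propositional equality rather than `_≈_`, so that goals can be rewritten along it.
  ⟦⟧-canonical : ∀ φ → ⟦ φ ⟧ canonical ≡ lift φ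
  ⟦⟧-canonical (var n) = refl
  ⟦⟧-canonical (α ∨ β) rewrite ⟦⟧-canonical α | ⟦⟧-canonical β = refl
  ⟦⟧-canonical (α ∧ β) rewrite ⟦⟧-canonical α | ⟦⟧-canonical β = refl
  ⟦⟧-canonical (α ⟶ β) rewrite ⟦⟧-canonical α | ⟦⟧-canonical β = refl
  ⟦⟧-canonical (∼ α)   rewrite ⟦⟧-canonical α = refl
  ⟦⟧-canonical ⊥       = refl
  ⟦⟧-canonical ⊤       = refl

  ⊢⇒≈𝟏 : ∀ {φ} → ⊢ φ → ⟦ φ ⟧ canonical ≈ 𝟏
  ⊢⇒≈𝟏 {φ} d rewrite ⟦⟧-canonical φ = ⊤-intro , weaken d

  ≈𝟏⇒⊢ : ∀ {φ} → ⟦ φ ⟧ canonical ≈ 𝟏 → ⊢ φ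
  ≈𝟏⇒⊢ {φ} e rewrite ⟦⟧-canonical φ = MP (ax ax6) (proj₂ e)

RDPCH-equivalentSemantics : ∀ (c ℓ : Level) →
  IsEquivalentAlgebraicSemantics (RDPCH {c} {ℓ}) (RDPCH-logic {ℓ})
RDPCH-equivalentSemantics c ℓ = record
  { n = 1
  ; δ = λ _ → var zero
  ; ε = λ _ → ⊤
  ; m = 1
  ; Δ = λ _ → var zero ⟷ᴴ var (suc zero)
  ; completeness = λ Γ φ → mk⇔
      (λ d _ A A∈ v h → let open Soundness A A∈ in
        ≈𝟏 (sound v (λ {ψ} p → h _ (zero , ψ , p , refl)) d))
      -- The semantic consequence is instantiated only at the Lindenbaum algebra of `Γ`, where every
      -- member of `Γ` has value `𝟏`.
      (λ h → ≈𝟏⇒⊢ Γ (h zero (lindenbaum Γ) (lindenbaum∈RDPCH Γ) (canonical Γ)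
        λ { _ (_ , _ , p , refl) → ⊢⇒≈𝟏 Γ (premise p) }))
  ; equivalence⇒ = λ { φ ψ _ (_ , _ , refl) A A∈ v h →
      Soundness.⟷ᴴ-valid A A∈ v φ ψ (h _ refl) }
  ; equivalence⇐ = λ φ ψ A A∈ v h →
      Soundness.⟷ᴴ-equal A A∈ v φ ψ (h _ (zero , zero , refl))
  }

-- The existential alone leaves its witness open; the second component fixes the class as the
-- variety.
corollary3p9 : ∀ (c ℓ : Level) →
    BPAlgebraizable c ℓ (c ⊔ ℓ) (RDPCH-logic {ℓ}) ×
    IsEquivalentAlgebraicSemantics (RDPCH {c} {ℓ}) (RDPCH-logic {ℓ})
corollary3p9 c ℓ = (RDPCH , RDPCH-equivalentSemantics c ℓ) , RDPCH-equivalentSemantics c ℓ
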